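{- If $\tau=0011$ or $\tau=0112$, then $$f_\tau(x)=\frac{1-4x+5x^2-x^3}{(1-x)(1-2x)^2}$$ as formal power series in $x$, where $f_\tau(x)=\sum_{n\ge 0} b_n(\tau)x^n$ and $b_n(\tau)$ is the number of ascent sequences of length $n$ that avoid both patterns $021$ and $\tau$.
   Context: For a finite sequence $w=w_1\cdots w_n$ of integers, $\mathrm{asc}(w)$ is the number of indices $1\le i\le n-1$ with $w_i<w_{i+1}$. An ascent sequence of length $n\ge 1$ is a sequence $a_1\cdots a_n$ of non-negative integers such that $a_1=0$ and $a_i\le \mathrm{asc}(a_1\cdots a_{i-1})+1$ for $1<i\le n$; there is exactly one (empty) ascent sequence of length $0$. A sequence $\pi=\pi_1\cdots\pi_n$ contains a pattern $\tau=\tau_1\cdots\tau_m$ if there are indices $1\le i_1<\cdots<i_m\le n$ such that for all $j,k\in\{1,\dots,m\}$: $\pi_{i_j}<\pi_{i_k}$ iff $\tau_j<\tau_k$, and $\pi_{i_j}=\pi_{i_k}$ iff $\tau_j=\tau_k$; otherwise $\pi$ avoids $\tau$. For a pattern $\tau$, $B_n(\tau)$ is the set of ascent sequences of length $n$ avoiding both $021$ and $\tau$ (with $B_0(\tau)$ consisting of the empty sequence), and $b_n(\tau)=|B_n(\tau)|$. -}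

module Defs where

open import Data.Bool.Base using (Bool; true; false; if_then_else_)
open import Data.Fin.Base as Fin using (Fin; zero; suc; toℕ; finToFun; funToFin)
open import Data.Fin.Properties using (all?; any?; finToFun-funToFin; toℕ<n)
import Data.Fin.Properties as Fin
open import Data.Integer.Base as ℤ using (ℤ; +_; 0ℤ; 1ℤ)
import Data.Integer.Properties as ℤ
open import Data.Integer.Tactic.RingSolver using (solve-∀)
open import Data.List.Base
  using (List; []; _∷_; length; lookup; take; upTo; filter; cartesianProductWith)
open import Data.List.Membership.Propositional using (_∈_)
open import Data.List.Membership.Propositional.Properties
  using (∈-upTo⁺; ∈-filter⁺; ∈-filter⁻; ∈-cartesianProductWith⁺; ∈-cartesianProductWith⁻)
open import Data.List.Properties using (length-take; ∷-injective)
open import Data.List.Relation.Unary.All using ([])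
open import Data.List.Relation.Unary.AllPairs using ([]; _∷_)
open import Data.List.Relation.Unary.Any using (here)
open import Data.List.Relation.Unary.Unique.Propositional using (Unique)
open import Data.List.Relation.Unary.Unique.Propositional.Properties
  using (upTo⁺; cartesianProductWith⁺; filter⁺)
open import Data.Nat.Base using (ℕ; zero; suc; _+_; _∸_; _≤_; _<_; _<ᵇ_; z≤n; s≤s)
open import Data.Nat.Properties
open import Data.Product.Base using (∃-syntax; _×_; _,_; proj₁; proj₂)
open import Function.Base using (_∘_)
open import Function.Bundles using (_⇔_; mk⇔; Equivalence)
open import Relation.Binary.PropositionalEquality
  using (_≡_; refl; sym; trans; cong; cong₂; subst; subst₂)
open import Relation.Nullary using (Dec; ¬_)
open import Relation.Nullary.Decidable using (map′; _×-dec_; _→-dec_; ¬?)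
open import Relation.Unary using (Decidable)

asc : List ℕ → ℕ
asc []          = 0
asc (_ ∷ [])    = 0
asc (x ∷ y ∷ w) = (if x <ᵇ y then 1 else 0) + asc (y ∷ w)

-- Positions are counted from 0, so `take (toℕ i) w` is the part of w
-- strictly before position i.
IsAscentSequence : List ℕ → Set
IsAscentSequence w = (i : Fin (length w)) →
  (toℕ i ≡ 0 → lookup w i ≡ 0) ×
  (0 < toℕ i → lookup w i ≤ asc (take (toℕ i) w) + 1)

IsOccurrence : (π τ : List ℕ) → (Fin (length τ) → Fin (length π)) → Set
IsOccurrence π τ ι =
  (∀ j k → j Fin.< k → ι j Fin.< ι k) ×
  (∀ j k → (lookup π (ι j) < lookup π (ι k) ⇔ lookup τ j < lookup τ k) ×
           (lookup π (ι j) ≡ lookup π (ι k) ⇔ lookup τ j ≡ lookup τ k))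

Contains Avoids : (π τ : List ℕ) → Set
Contains π τ = ∃[ ι ] IsOccurrence π τ ι
Avoids   π τ = ¬ Contains π τ

B : (n : ℕ) (τ w : List ℕ) → Set
B n τ w = length w ≡ n × IsAscentSequence w ×
          Avoids w (0 ∷ 2 ∷ 1 ∷ []) × Avoids w τ

private
  ⇔-dec : {P Q : Set} → Dec P → Dec Q → Dec (P ⇔ Q)
  ⇔-dec P? Q? = map′ (λ (f , g) → mk⇔ f g)
                     (λ e → Equivalence.to e , Equivalence.from e)
                     ((P? →-dec Q?) ×-dec (Q? →-dec P?))

isAscentSequence? : Decidable IsAscentSequence
isAscentSequence? w = all? λ i →
  ((toℕ i ≟ 0) →-dec (lookup w i ≟ 0)) ×-dec
  ((0 <? toℕ i) →-dec (lookup w i ≤? asc (take (toℕ i) w) + 1))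

isOccurrence? : ∀ π τ → Decidable (IsOccurrence π τ)
isOccurrence? π τ ι =
  (all? λ j → all? λ k → (j Fin.<? k) →-dec (ι j Fin.<? ι k)) ×-dec
  (all? λ j → all? λ k →
    ⇔-dec (lookup π (ι j) <? lookup π (ι k)) (lookup τ j <? lookup τ k) ×-dec
    ⇔-dec (lookup π (ι j) ≟ lookup π (ι k)) (lookup τ j ≟ lookup τ k))

private
  IsOccurrence-resp : ∀ π τ {ι κ} → (∀ j → ι j ≡ κ j) →
                      IsOccurrence π τ ι → IsOccurrence π τ κ
  IsOccurrence-resp π τ eq (mono , iso) =
    (λ j k j<k → subst₂ Fin._<_ (eq j) (eq k) (mono j k j<k)) ,
    (λ j k → subst₂ (λ a b →
       (lookup π a < lookup π b ⇔ lookup τ j < lookup τ k) ×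
       (lookup π a ≡ lookup π b ⇔ lookup τ j ≡ lookup τ k))
       (eq j) (eq k) (iso j k))

contains? : ∀ π τ → Dec (Contains π τ)
contains? π τ = map′
  (λ (c , occ) → finToFun c , occ)
  (λ (ι , occ) → funToFin ι ,
     IsOccurrence-resp π τ (λ j → sym (finToFun-funToFin ι j)) occ)
  (any? λ c → isOccurrence? π τ (finToFun c))

B? : ∀ n τ → Decidable (B n τ)
B? n τ w = (length w ≟ n) ×-dec isAscentSequence? w ×-dec
           ¬? (contains? w (0 ∷ 2 ∷ 1 ∷ [])) ×-dec ¬? (contains? w τ)

words : (k n : ℕ) → List (List ℕ)
words k zero    = [] ∷ []
words k (suc n) = cartesianProductWith _∷_ (upTo k) (words k n)

-- The entries of an ascent sequence of length n are smaller than n, so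
-- searching `words n n` misses nothing: see `∈-listB` and `listB-unique`.
listB : (n : ℕ) (τ : List ℕ) → List (List ℕ)
listB n τ = filter (B? n τ) (words n n)

b : (n : ℕ) (τ : List ℕ) → ℕ
b n τ = length (listB n τ)

private
  words-unique : ∀ k n → Unique (words k n)
  words-unique k zero    = [] ∷ []
  words-unique k (suc n) =
    cartesianProductWith⁺ _∷_ ∷-injective (upTo⁺ k) (words-unique k n)

  ∈-words : ∀ k w → (∀ i → lookup w i < k) → w ∈ words k (length w)
  ∈-words k []      _  = here refl
  ∈-words k (x ∷ w) lt =
    ∈-cartesianProductWith⁺ _∷_ (∈-upTo⁺ (lt zero)) (∈-words k w (lt ∘ suc))

  asc-bound : ∀ w → asc w ≤ length w ∸ 1
  asc-bound []          = z≤n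
  asc-bound (_ ∷ [])    = z≤n
  asc-bound (x ∷ y ∷ w) = +-mono-≤ (step x y) (asc-bound (y ∷ w))
    where
    le : ∀ c → (if c then 1 else 0) ≤ 1
    le true  = ≤-refl
    le false = z≤n
    step : ∀ x y → (if x <ᵇ y then 1 else 0) ≤ 1
    step x y = le (x <ᵇ y)

  entry-bound : ∀ w → IsAscentSequence w → ∀ i → lookup w i < length w
  entry-bound w A i with toℕ i in eq | A i | toℕ<n i
  ... | zero  | first , _ | i<n = subst (_< length w) (sym (first refl)) i<n
  ... | suc m | _ , later | i<n = ≤-<-trans (later (s≤s z≤n)) (≤-<-trans bound i<n)
    where
    open ≤-Reasoning
    bound : asc (take (suc m) w) + 1 ≤ suc m
    bound = begin
      asc (take (suc m) w) + 1           ≤⟨ +-monoˡ-≤ 1 (asc-bound (take (suc m) w)) ⟩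
      (length (take (suc m) w) ∸ 1) + 1  ≤⟨ +-monoˡ-≤ 1 (∸-monoˡ-≤ 1
                                             (≤-trans (≤-reflexive (length-take (suc m) w))
                                                      (m⊓n≤m (suc m) (length w)))) ⟩
      m + 1                              ≡⟨ +-comm m 1 ⟩
      suc m                              ∎

private
  ∈-filter⇔ : {P : List ℕ → Set} (P? : Decidable P) (xs : List (List ℕ)) →
              ∀ w → (P w → w ∈ xs) → w ∈ filter P? xs ⇔ P w
  ∈-filter⇔ P? xs w P⇒∈ = mk⇔
    (λ w∈ → proj₂ (∈-filter⁻ P? {xs = xs} w∈))
    (λ Pw → ∈-filter⁺ P? (P⇒∈ Pw) Pw)

  B⇒∈-words : ∀ n τ w → B n τ w → w ∈ words n n
  B⇒∈-words n τ w (refl , A , _) = ∈-words (length w) w (entry-bound w A)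

∈-listB : ∀ n τ w → w ∈ listB n τ ⇔ B n τ w
∈-listB n τ w = ∈-filter⇔ {P = B n τ} (B? n τ) (words n n) w (B⇒∈-words n τ w)

listB-unique : ∀ n τ → Unique (listB n τ)
listB-unique n τ = filter⁺ (B? n τ) (words-unique n n)

PowerSeries : Set
PowerSeries = ℕ → ℤ

infix  4 _≈_
infixl 7 _·_ _/_⟨_⟩

_≈_ : PowerSeries → PowerSeries → Set
f ≈ g = ∀ n → f n ≡ g n

-- ∑≤ n h = h 0 + h 1 + ⋯ + h n
∑≤ : ℕ → (ℕ → ℤ) → ℤ
∑≤ zero    h = h 0
∑≤ (suc n) h = h 0 ℤ.+ ∑≤ n (h ∘ suc)

_·_ : PowerSeries → PowerSeries → PowerSeries
(f · g) n = ∑≤ n λ i → f i ℤ.* g (n ∸ i)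

-- Coefficients in order of increasing degree.
poly : List ℤ → PowerSeries
poly []       _       = 0ℤ
poly (a ∷ as) zero    = a
poly (a ∷ as) (suc n) = poly as n

-- Long division by a series q with constant term 1: the quotient has
-- constant term p 0, and its shift is (p - p 0 · q) / x divided by q.
-- By `/-correct` and `/-unique` it is the only series f with f · q ≈ p.
_/_⟨_⟩ : (p q : PowerSeries) → q 0 ≡ 1ℤ → PowerSeries
(p / q ⟨ q₀ ⟩) zero    = p 0
(p / q ⟨ q₀ ⟩) (suc n) =
  ((λ k → p (suc k) ℤ.- p 0 ℤ.* q (suc k)) / q ⟨ q₀ ⟩) n

/-correct : ∀ p q q₀ → (p / q ⟨ q₀ ⟩) · q ≈ p
/-correct p q q₀ zero    = trans (cong (p 0 ℤ.*_) q₀) (ℤ.*-identityʳ (p 0))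
/-correct p q q₀ (suc n) = trans
  (cong (λ z → p 0 ℤ.* q (suc n) ℤ.+ z) (/-correct _ q q₀ n))
  (cancel (p 0 ℤ.* q (suc n)) (p (suc n)))
  where
  cancel : ∀ a c → a ℤ.+ (c ℤ.- a) ≡ c
  cancel = solve-∀

/-unique : ∀ f p q q₀ → f · q ≈ p → f ≈ p / q ⟨ q₀ ⟩
/-unique f p q q₀ eq zero = trans
  (sym (trans (cong (f 0 ℤ.*_) q₀) (ℤ.*-identityʳ (f 0)))) (eq 0)
/-unique f p q q₀ eq (suc n) = /-unique (f ∘ suc) _ q q₀ shifted n
  where
  move : ∀ a s → s ≡ (a ℤ.+ s) ℤ.- a
  move = solve-∀
  shifted : (f ∘ suc) · q ≈ λ k → p (suc k) ℤ.- p 0 ℤ.* q (suc k)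
  shifted k = trans (move (f 0 ℤ.* q (suc k)) _)
    (cong₂ ℤ._-_ (eq (suc k))
      (cong (ℤ._* q (suc k)) (/-unique f p q q₀ eq zero)))

genFun : List ℕ → PowerSeries
genFun τ n = + b n τ

{-# OPTIONS --safe #-}

-- In an ascent sequence avoiding 021 the nonzero letters increase weakly, so
-- for either pattern τ a finite amount of information about a prefix (its
-- largest letter, its number of ascents and which repetitions it contains)
-- decides which letters may follow.  This gives a deterministic automaton for
-- each τ; counting its paths yields b (n + 1) = z n in both cases, where
-- z (n + 1) = z n + s n, s (n + 1) = 2 s n + 2 ^ n and z 0 = s 0 = 1, and this
-- sequence satisfies the linear recurrence of the denominator.
--
-- Prefixes are kept reversed, so that reading a letter x turns r into x ∷ r and
-- the whole word is r ʳ++ w, where w is what is left to read.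
module Submission where

open import Defs
open import Data.Bool.Base using (if_then_else_; true; false)
import Data.Bool.Properties as Bool
open import Data.Fin.Base as Fin using (Fin; zero; suc; toℕ)
open import Data.Fin.Patterns using (0F; 1F; 2F; 3F)
import Data.Fin.Properties as Fin
import Data.Integer.Base as ℤ
open import Data.Integer.Base using (+_; -_; 0ℤ; 1ℤ)
import Data.Integer.Properties as ℤ
import Data.Integer.Tactic.RingSolver as ℤSolver
open import Data.List.Base
  using (List; []; _∷_; [_]; _ʳ++_; length; lookup; map; reverse; concatMap; tabulate; take)
open import Data.List.Membership.Propositional using (_∈_; find)
open import Data.List.Membership.Propositional.Properties
  using (∈-map⁺; ∈-map⁻; ∈-concatMap⁺; ∈-concatMap⁻)
open import Data.List.Membership.Propositional.Properties.WithK using (unique∧set⇒bag)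
open import Data.List.Properties
  using (length-++; length-map; ∷-injectiveˡ; ∷-injectiveʳ; tabulate-cong)
open import Data.List.Relation.Binary.BagAndSetEquality using (∼bag⇒↭)
open import Data.List.Relation.Binary.Disjoint.Propositional using (Disjoint)
open import Data.List.Relation.Binary.Permutation.Propositional.Properties using (↭-length)
open import Data.List.Relation.Binary.Sublist.Propositional
  using (_⊆_; []; _∷_; _∷ʳ_; minimum; ⊆-trans; ⊆-refl)
open import Data.List.Relation.Binary.Sublist.Propositional.Properties
  using (∷ˡ⁻; ∷ʳ⁻; reverse⁺; reverse⁻; All-resp-⊆)
open import Data.List.Relation.Unary.All as All using (All; []; _∷_)
import Data.List.Relation.Unary.All.Properties as All
open import Data.List.Relation.Unary.AllPairs as AllPairs using ([]; _∷_)
import Data.List.Relation.Unary.AllPairs.Properties as AllPairs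
open import Data.List.Relation.Unary.Any as Any using (here; there)
open import Data.List.Relation.Unary.Unique.Propositional using (Unique)
open import Data.List.Relation.Unary.Unique.Propositional.Properties using (map⁺; concat⁺)
open import Data.Nat.Base
  using (ℕ; zero; suc; _+_; _≤_; _<_; _<ᵇ_; z≤n; s≤s; s≤s⁻¹; z<s; s<s; s<s⁻¹)
open import Data.Nat.ListAction using (sum)
open import Data.Nat.Properties
import Data.Nat.Tactic.RingSolver as ℕSolver
open import Data.Product.Base using (∃-syntax; _×_; _,_; proj₁; proj₂)
open import Data.Sum.Base using (_⊎_; inj₁; inj₂)
open import Function.Base using (_∘_)
open import Function.Bundles using (_⇔_; mk⇔; Equivalence)
open import Function.Construct.Composition using (_⇔-∘_)
open import Relation.Binary.Definitions using (tri<; tri≈; tri>)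
open import Relation.Binary.PropositionalEquality hiding ([_])
open import Relation.Nullary using (¬_; contradiction; yes; no)

open Equivalence using (to; from)

-- Enumeration of the words readable by an automaton

module Generation {S : Set} (next : S → List (ℕ × S)) where

  data Accepts : S → List ℕ → Set where
    []  : ∀ {s} → Accepts s []
    _∷_ : ∀ {s x s′ w} → (x , s′) ∈ next s → Accepts s′ w → Accepts s (x ∷ w)

  gen : ℕ → S → List (List ℕ)
  branch : ℕ → ℕ × S → List (List ℕ)
  branch n (x , s) = map (x ∷_) (gen n s)

  gen zero    s = [ [] ]
  gen (suc n) s = concatMap (branch n) (next s)

  ∈-gen⁺ : ∀ {s w} → Accepts s w → w ∈ gen (length w) s
  ∈-gen⁺ []        = here refl
  ∈-gen⁺ {w = x ∷ w} (e ∷ acc) =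
    ∈-concatMap⁺ (branch (length w)) (Any.map (λ { refl → ∈-map⁺ (x ∷_) (∈-gen⁺ acc) }) e)

  ∈-gen⁻ : ∀ n {s w} → w ∈ gen n s → length w ≡ n × Accepts s w
  ∈-gen⁻ zero    (here refl) = refl , []
  ∈-gen⁻ (suc n) {s} w∈ with find (∈-concatMap⁻ (branch n) {xs = next s} w∈)
  ... | (x , s′) , e , w∈ with ∈-map⁻ (x ∷_) w∈
  ...   | v , v∈ , refl with ∈-gen⁻ n v∈
  ...     | len , acc = cong suc len , e ∷ acc

  -- Edges leaving one state carry different letters, so their branches are disjoint already by the
  -- first letter.
  gen-unique : (∀ s → Unique (map proj₁ (next s))) → ∀ n s → Unique (gen n s)
  gen-unique distinct zero    s = [] ∷ []
  gen-unique distinct (suc n) s = concat⁺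
    (All.map⁺ (All.universal (λ (x , s′) → map⁺ ∷-injectiveʳ (gen-unique distinct n s′)) (next s)))
    (AllPairs.map⁺ (AllPairs.map disjoint (AllPairs.map⁻ (distinct s))))
    where
    disjoint : ∀ {t u} → proj₁ t ≢ proj₁ u → Disjoint (branch n t) (branch n u)
    disjoint {x , _} {y , _} x≢y (w∈ , w∈′) with ∈-map⁻ (x ∷_) w∈ | ∈-map⁻ (y ∷_) w∈′
    ... | _ , _ , refl | _ , _ , eq = x≢y (∷-injectiveˡ eq)

  -- Reduces counting to guessing `v`: it suffices that the guess satisfies the transfer recursion
  -- at every state.
  length-gen : (v : ℕ → S → ℕ) → (∀ s → v 0 s ≡ 1) →
               (∀ n s → v (suc n) s ≡ sum (map (v n ∘ proj₂) (next s))) →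
               ∀ n s → length (gen n s) ≡ v n s
  length-gen v v₀ v₊ zero    s = sym (v₀ s)
  length-gen v v₀ v₊ (suc n) s = trans (total (next s)) (sym (v₊ n s))
    where
    total : ∀ ts → length (concatMap (branch n) ts) ≡ sum (map (v n ∘ proj₂) ts)
    total []              = refl
    total ((x , s′) ∷ ts) = trans (length-++ (branch n (x , s′)))
      (cong₂ _+_ (trans (length-map (x ∷_) (gen n s′)) (length-gen v v₀ v₊ n s′)) (total ts))

-- Ascents and ascent sequences read letter by letter

asc-ʳ++ : ∀ r x w → asc (r ʳ++ (x ∷ w)) ≡ asc (r ʳ++ [ x ]) + asc (x ∷ w)
asc-ʳ++ []      x w = refl
asc-ʳ++ (y ∷ r) x w = begin
  asc (r ʳ++ (y ∷ x ∷ w))                    ≡⟨ asc-ʳ++ r y (x ∷ w) ⟩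
  asc (r ʳ++ [ y ]) + (δ + asc (x ∷ w))      ≡⟨ +-assoc (asc (r ʳ++ [ y ])) δ _ ⟨
  asc (r ʳ++ [ y ]) + δ + asc (x ∷ w)        ≡⟨ cong (λ d → asc (r ʳ++ [ y ]) + d + asc (x ∷ w))
                                                     (+-identityʳ δ) ⟨
  asc (r ʳ++ [ y ]) + (δ + 0) + asc (x ∷ w)  ≡⟨ cong (_+ asc (x ∷ w)) (asc-ʳ++ r y [ x ]) ⟨
  asc (r ʳ++ (y ∷ x ∷ [])) + asc (x ∷ w)     ∎
  where
  open ≡-Reasoning
  δ = if y <ᵇ x then 1 else 0

asc-reverse-∷ : ∀ x y r →
  asc (reverse (x ∷ y ∷ r)) ≡ asc (reverse (y ∷ r)) + (if y <ᵇ x then 1 else 0)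
asc-reverse-∷ x y r = trans (asc-ʳ++ r y [ x ])
  (cong (λ d → asc (reverse (y ∷ r)) + d) (+-identityʳ _))

-- AscFrom r w: the letters of w may be read one by one after the prefix reverse r.
data AscFrom : (r w : List ℕ) → Set where
  []  : ∀ {r} → AscFrom r []
  _∷_ : ∀ {r x w} → x ≤ asc (reverse r) + 1 → AscFrom (x ∷ r) w → AscFrom r (x ∷ w)

AscFrom-lookup : ∀ {r w} → AscFrom r w → ∀ i → lookup w i ≤ asc (r ʳ++ take (toℕ i) w) + 1
AscFrom-lookup (le ∷ _) zero    = le
AscFrom-lookup (_ ∷ A)  (suc i) = AscFrom-lookup A i

AscFrom-tabulate : ∀ {r} w → (∀ i → lookup w i ≤ asc (r ʳ++ take (toℕ i) w) + 1) → AscFrom r w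
AscFrom-tabulate []      _  = []
AscFrom-tabulate (x ∷ w) le = le zero ∷ AscFrom-tabulate w (le ∘ suc)

-- Position 0 obeys its own rule, so the first letter is split off; every later letter falls under
-- the single bound of `AscFrom`.
IsAscentSequence-∷ : ∀ x w → IsAscentSequence (x ∷ w) ⇔ (x ≡ 0 × AscFrom [ x ] w)
IsAscentSequence-∷ x w = mk⇔
  (λ A → proj₁ (A zero) refl , AscFrom-tabulate w (λ i → proj₂ (A (suc i)) z<s))
  (λ { (x≡0 , A) zero    → (λ _ → x≡0) , λ ()
     ; (x≡0 , A) (suc i) → (λ ()) , λ _ → AscFrom-lookup A i })

-- Pattern occurrences as sublists

Monotone : ∀ {k n} → (Fin k → Fin n) → Set
Monotone ι = ∀ i j → i Fin.< j → ι i Fin.< ι j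

unsuc : ∀ {k n} (ι : Fin k → Fin (suc n)) → (∀ j → 0 < toℕ (ι j)) →
        ∃[ κ ] ∀ j → ι j ≡ suc {n} (κ j)
unsuc {k} {n} ι pos = (λ j → proj₁ (pred (ι j) (pos j))) , (λ j → proj₂ (pred (ι j) (pos j)))
  where
  pred : ∀ i → 0 < toℕ i → ∃[ j ] i ≡ suc {n} j
  pred (suc i) _ = i , refl

-- Induction on `π`: its head is kept if `ι` starts there and dropped otherwise. Monotonicity keeps
-- the remaining positions away from 0, so `unsuc` can lower them.
tabulate-⊆ : ∀ {A : Set} (π : List A) k (ι : Fin k → Fin (length π)) → Monotone ι →
             tabulate (lookup π ∘ ι) ⊆ π
tabulate-⊆ π zero ι mono = minimum π
tabulate-⊆ [] (suc k) ι mono with () ← ι zero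
tabulate-⊆ (x ∷ π) (suc k) ι mono with ι zero in eq
... | suc i = subst (_⊆ x ∷ π)
        (trans (tabulate-cong λ j → sym (cong (lookup (x ∷ π)) (κ≡ j)))
               (cong (λ i → lookup (x ∷ π) i ∷ tabulate (lookup (x ∷ π) ∘ ι ∘ suc)) eq))
        (x ∷ʳ tabulate-⊆ π (suc k) κ λ i j i<j →
          s<s⁻¹ (subst₂ Fin._<_ (κ≡ i) (κ≡ j) (mono i j i<j)))
  where
  pos : ∀ j → 0 < toℕ (ι j)
  pos zero    = subst (λ i → 0 < toℕ i) (sym eq) z<s
  pos (suc j) = <-trans (pos zero) (mono zero (suc j) z<s)
  κ  = proj₁ (unsuc ι pos)
  κ≡ = proj₂ (unsuc ι pos)
... | zero = subst (λ t → x ∷ t ⊆ x ∷ π)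
        (tabulate-cong λ j → sym (cong (lookup (x ∷ π)) (κ≡ j)))
        (refl ∷ tabulate-⊆ π k κ λ i j i<j →
          s<s⁻¹ (subst₂ Fin._<_ (κ≡ i) (κ≡ j) (mono (suc i) (suc j) (s<s i<j))))
  where
  pos : ∀ j → 0 < toℕ (ι (suc j))
  pos j = subst (Fin._< ι (suc j)) eq (mono zero (suc j) z<s)
  κ  = proj₁ (unsuc (ι ∘ suc) pos)
  κ≡ = proj₂ (unsuc (ι ∘ suc) pos)

embedding : ∀ {A : Set} {σ π : List A} → σ ⊆ π → Fin (length σ) → Fin (length π)
embedding (_ ∷ʳ p) j       = suc (embedding p j)
embedding (_ ∷ p)  zero    = zero
embedding (_ ∷ p)  (suc j) = suc (embedding p j)

embedding-mono : ∀ {A : Set} {σ π : List A} (p : σ ⊆ π) → Monotone (embedding p)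
embedding-mono (_ ∷ʳ p) i       j       i<j = s<s (embedding-mono p i j i<j)
embedding-mono (_ ∷ p)  zero    (suc j) i<j = z<s
embedding-mono (_ ∷ p)  (suc i) (suc j) i<j = s<s (embedding-mono p i j (s<s⁻¹ i<j))

lookup-embedding : ∀ {A : Set} {σ π : List A} (p : σ ⊆ π) j → lookup π (embedding p j) ≡ lookup σ j
lookup-embedding (_ ∷ʳ p)   j       = lookup-embedding p j
lookup-embedding (refl ∷ p) zero    = refl
lookup-embedding (_ ∷ p)    (suc j) = lookup-embedding p j

record StrictlyIncreasing (φ : ℕ → ℕ) : Set where
  constructor increasing
  field mono : ∀ n → φ n < φ (suc n)

  <-mono : ∀ {m n} → m < n → φ m < φ n
  <-mono {m} {suc n} m<1+n with m≤n⇒m<n∨m≡n (s≤s⁻¹ m<1+n)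
  ... | inj₁ m<n  = <-trans (<-mono m<n) (mono n)
  ... | inj₂ refl = mono m

  <-reflects : ∀ {m n} → φ m < φ n → m < n
  <-reflects {m} {n} lt with <-cmp m n
  ... | tri< m<n _ _  = m<n
  ... | tri≈ _ refl _ = contradiction lt (<-irrefl refl)
  ... | tri> _ _ n<m  = contradiction lt (<-asym (<-mono n<m))

  injective : ∀ {m n} → φ m ≡ φ n → m ≡ n
  injective {m} {n} eq with <-cmp m n
  ... | tri< m<n _ _ = contradiction eq (<⇒≢ (<-mono m<n))
  ... | tri≈ _ m≡n _ = m≡n
  ... | tri> _ _ n<m = contradiction (sym eq) (<⇒≢ (<-mono n<m))

-- A strictly increasing `φ` preserves and reflects both order and equality, so a copy of `map φ τ`
-- is order-isomorphic to `τ`.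
⊆⇒contains : ∀ {φ} → StrictlyIncreasing φ → ∀ π τ → map φ τ ⊆ π → Contains π τ
⊆⇒contains {φ} inc π τ p = ι , mono′ , λ j k →
  subst₂ (λ a b → (a < b ⇔ lookup τ j < lookup τ k) × (a ≡ b ⇔ lookup τ j ≡ lookup τ k))
    (sym (value j)) (sym (value k))
    (mk⇔ <-reflects <-mono , mk⇔ injective (cong φ))
  where
  open StrictlyIncreasing inc
  cast : Fin (length τ) → Fin (length (map φ τ))
  cast = Fin.cast (sym (length-map φ τ))
  ι = embedding p ∘ cast
  mono′ : Monotone ι
  mono′ i j i<j = embedding-mono p _ _
    (subst₂ _<_ (sym (Fin.toℕ-cast _ i)) (sym (Fin.toℕ-cast _ j)) i<j)
  lookup-map : ∀ τ .(eq : length τ ≡ length (map φ τ)) j →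
               lookup (map φ τ) (Fin.cast eq j) ≡ φ (lookup τ j)
  lookup-map (_ ∷ τ) _ zero    = refl
  lookup-map (_ ∷ τ) _ (suc j) = lookup-map τ _ j
  value : ∀ j → lookup π (ι j) ≡ φ (lookup τ j)
  value j = trans (lookup-embedding p (cast j)) (lookup-map τ _ j)

-- Extends three chosen letters to a letter map on all naturals, as `⊆⇒contains` expects; from index
-- 3 on the values simply continue past `c`.
levels : ℕ → ℕ → ℕ → ℕ → ℕ
levels a b c 0             = a
levels a b c 1             = b
levels a b c (suc (suc n)) = n + c

levels-increasing : ∀ {a b c} → a < b → b < c → StrictlyIncreasing (levels a b c)
levels-increasing a<b b<c = increasing λ
  { 0 → a<b ; 1 → b<c ; (suc (suc n)) → n<1+n _ }

-- Witnesses live in a reversed word, hence the letters of the pattern are listed backwards.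
record Has021 (r : List ℕ) : Set where
  constructor has021
  field {x y z} : ℕ
        x<z     : x < z
        z<y     : z < y
        sub     : z ∷ y ∷ x ∷ [] ⊆ r

record Has0011 (r : List ℕ) : Set where
  constructor has0011
  field {x y} : ℕ
        x<y   : x < y
        sub   : y ∷ y ∷ x ∷ x ∷ [] ⊆ r

record Has0112 (r : List ℕ) : Set where
  constructor has0112
  field {x y z} : ℕ
        x<y     : x < y
        y<z     : y < z
        sub     : z ∷ y ∷ y ∷ x ∷ [] ⊆ r

contains⇒⊆ : ∀ π τ ((ι , _) : Contains π τ) → reverse (tabulate (lookup π ∘ ι)) ⊆ reverse π
contains⇒⊆ π τ (ι , mono , _) = reverse⁺ (tabulate-⊆ π _ ι mono)

contains-021 : ∀ w → Contains w (0 ∷ 2 ∷ 1 ∷ []) ⇔ Has021 (reverse w)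
contains-021 w = mk⇔
  (λ c@(ι , _ , iso) → has021
    (from (proj₁ (iso 0F 2F)) z<s)
    (from (proj₁ (iso 2F 1F)) (s<s z<s))
    (contains⇒⊆ w _ c))
  (λ (has021 x<z z<y sub) → ⊆⇒contains (levels-increasing x<z z<y) w _ (reverse⁻ sub))

contains-0011 : ∀ w → Contains w (0 ∷ 0 ∷ 1 ∷ 1 ∷ []) ⇔ Has0011 (reverse w)
contains-0011 w = mk⇔
  (λ c@(ι , _ , iso) → has0011
    (from (proj₁ (iso 0F 2F)) z<s)
    -- Positions 1 and 3 carry the letters of positions 0 and 2, which gives the sublist the shape
    -- y, y, x, x.
    (subst₂ (λ x y → y ∷ lookup w (ι 2F) ∷ x ∷ lookup w (ι 0F) ∷ [] ⊆ reverse w)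
      (sym (from (proj₂ (iso 0F 1F)) refl))
      (sym (from (proj₂ (iso 2F 3F)) refl))
      (contains⇒⊆ w _ c)))
  -- The pattern has two distinct letters; the third level is the filler y + 1.
  (λ (has0011 x<y sub) → ⊆⇒contains (levels-increasing x<y (n<1+n _)) w _ (reverse⁻ sub))

contains-0112 : ∀ w → Contains w (0 ∷ 1 ∷ 1 ∷ 2 ∷ []) ⇔ Has0112 (reverse w)
contains-0112 w = mk⇔
  (λ c@(ι , _ , iso) → has0112
    (from (proj₁ (iso 0F 1F)) z<s)
    (from (proj₁ (iso 1F 3F)) (s<s z<s))
    (subst (λ y → lookup w (ι 3F) ∷ y ∷ lookup w (ι 1F) ∷ lookup w (ι 0F) ∷ [] ⊆ reverse w)
      (sym (from (proj₂ (iso 1F 2F)) refl))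
      (contains⇒⊆ w _ c)))
  (λ (has0112 x<y y<z sub) → ⊆⇒contains (levels-increasing x<y y<z) w _ (reverse⁻ sub))

-- Facts about prefixes common to both patterns

Clean : (List ℕ → Set) → List ℕ → Set
Clean Has r = ¬ Has021 r × ¬ Has r

<ᵇ-< : ∀ {m n} → m < n → (m <ᵇ n) ≡ true
<ᵇ-< {m} {n} lt = Bool.T-≡ .to (<⇒<ᵇ lt)

<ᵇ-≥ : ∀ {m n} → n ≤ m → (m <ᵇ n) ≡ false
<ᵇ-≥ {m} {zero} le = refl
<ᵇ-≥ {suc m} {suc n} le = <ᵇ-≥ (s≤s⁻¹ le)

asc-ascent : ∀ {x y r} → y < x → asc (reverse (x ∷ y ∷ r)) ≡ suc (asc (reverse (y ∷ r)))
asc-ascent {x} {y} {r} y<x rewrite asc-reverse-∷ x y r | <ᵇ-< y<x = +-comm _ 1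

asc-non-ascent : ∀ {x y r} → x ≤ y → asc (reverse (x ∷ y ∷ r)) ≡ asc (reverse (y ∷ r))
asc-non-ascent {x} {y} {r} x≤y rewrite asc-reverse-∷ x y r | <ᵇ-≥ x≤y = +-identityʳ _

asc-≤ : ∀ x y r → asc (reverse (y ∷ r)) ≤ asc (reverse (x ∷ y ∷ r))
asc-≤ x y r rewrite asc-reverse-∷ x y r = m≤m+n _ _

-- Facts about a reversed prefix r with largest letter m and a ascents that do not
-- depend on τ.
record Reach (m a : ℕ) (r : List ℕ) : Set where
  field
    ascents  : asc (reverse r) ≡ a
    bounded  : All (_≤ m) r
    has-zero : 0 ∷ [] ⊆ r
    has-top  : 0 < m → m ∷ 0 ∷ [] ⊆ r
    no-021   : ¬ Has021 r

  ∈-bounded : ∀ {x σ} → x ∷ σ ⊆ r → x ≤ m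
  ∈-bounded p = All.head (All-resp-⊆ p bounded)

  letter-bound : ∀ {x} → x ≤ asc (reverse r) + 1 → x ≤ suc a
  letter-bound {x} le = subst (x ≤_) (trans (+-comm _ 1) (cong suc ascents)) le

  letter-bound⁻ : ∀ {x} → x ≤ suc a → x ≤ asc (reverse r) + 1
  letter-bound⁻ {x} le = subst (x ≤_) (sym (trans (+-comm _ 1) (cong suc ascents))) le

  -- A nonzero letter below `m` would be the 1 of a 021 whose 0 and 2 are the letters 0 and `m` of
  -- `has-top`.
  zero-or-top : ∀ {x} → ¬ Has021 (x ∷ r) → x ≡ 0 ⊎ m ≤ x
  zero-or-top {zero}  _ = inj₁ refl
  zero-or-top {suc x} c with m ≤? suc x
  ... | yes m≤x = inj₂ m≤x
  ... | no  m≰x = contradiction (has021 z<s (≰⇒> m≰x) (refl ∷ has-top (≤-trans z<s (≰⇒> m≰x)))) c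

open Reach

Has021-tail : ∀ {x r} → Has021 r → Has021 (x ∷ r)
Has021-tail (has021 x<z z<y p) = has021 x<z z<y (_ ∷ʳ p)

reach-zero : ∀ {m a r} → Reach m a r → Reach m a (0 ∷ r)
reach-zero {r = []}    R with () ← has-zero R
reach-zero {r = h ∷ r} R = record
  { ascents  = trans (asc-non-ascent {0} {h} {r} z≤n) (ascents R)
  ; bounded  = z≤n ∷ bounded R
  ; has-zero = refl ∷ minimum _
  ; has-top  = λ 0<m → 0 ∷ʳ has-top R 0<m
  ; no-021   = λ { (has021 () _ (refl ∷ _))
                 ; (has021 x<z z<y (_ ∷ʳ p)) → no-021 R (has021 x<z z<y p) }
  }

-- The ascent count is left unevaluated because reading `m` again is an ascent exactly when the
-- preceding letter is smaller.
reach-≥ : ∀ {m n a r} → m ≤ n → Reach m a r → Reach n (asc (reverse (n ∷ r))) (n ∷ r)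
reach-≥ m≤n R = record
  { ascents  = refl
  ; bounded  = ≤-refl ∷ All.map (λ x≤m → ≤-trans x≤m m≤n) (bounded R)
  ; has-zero = _ ∷ʳ has-zero R
  ; has-top  = λ _ → refl ∷ has-zero R
  ; no-021   = λ { (has021 x<z z<y (refl ∷ p)) → <⇒≱ z<y (≤-trans (∈-bounded R p) m≤n)
                 ; (has021 x<z z<y (_ ∷ʳ p)) → no-021 R (has021 x<z z<y p) }
  }

-- The new letter exceeds all earlier ones, in particular the last, so it adds one ascent.
reach-> : ∀ {m n a r} → m < n → Reach m a r → Reach n (suc a) (n ∷ r)
reach-> {r = []}    m<n R with () ← has-zero R
reach-> {n = n} {r = h ∷ r} m<n R = subst (λ a → Reach n a (n ∷ h ∷ r))
  (trans (asc-ascent {n} {h} {r} (≤-<-trans (∈-bounded R (refl ∷ ⊆-refl)) m<n))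
         (cong suc (ascents R)))
  (reach-≥ (<⇒≤ m<n) R)

reach-init : Reach 0 0 [ 0 ]
reach-init = record
  { ascents  = refl
  ; bounded  = z≤n ∷ []
  ; has-zero = refl ∷ []
  ; has-top  = λ ()
  ; no-021   = λ { (has021 _ _ (_ ∷ʳ ())) ; (has021 _ _ (_ ∷ ())) }
  }

≤1+-split : ∀ {m x} → m ≤ x → x ≤ suc m → x ≡ m ⊎ x ≡ suc m
≤1+-split m≤x x≤1+m with m≤n⇒m<n∨m≡n x≤1+m
... | inj₁ x<1+m = inj₁ (≤-antisym (s≤s⁻¹ x<1+m) m≤x)
... | inj₂ x≡1+m = inj₂ x≡1+m

-- Counting avoiders with an automaton that maintains an invariant

module Counting
  {S : Set} (next : S → List (ℕ × S)) (distinct : ∀ s → Unique (map proj₁ (next s)))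
  {τ : List ℕ} {Has : List ℕ → Set} (contains : ∀ w → Contains w τ ⇔ Has (reverse w))
  (has-tail : ∀ {x r} → Has r → Has (x ∷ r))
  (Inv : S → List ℕ → Set) (inv-clean : ∀ {s r} → Inv s r → Clean Has r)
  (sound : ∀ {s r x s′} → Inv s r → (x , s′) ∈ next s →
           x ≤ asc (reverse r) + 1 × Inv s′ (x ∷ r))
  (complete : ∀ {s r x} → Inv s r → Clean Has (x ∷ r) → x ≤ asc (reverse r) + 1 →
              ∃[ s′ ] (x , s′) ∈ next s)
  where

  open Generation next

  -- Lets cleanness of the whole word serve at every prefix, where `complete` asks for it.
  clean-ʳ++ : ∀ {r} w → Clean Has (w ʳ++ r) → Clean Has r
  clean-ʳ++ []      c = c
  clean-ʳ++ (x ∷ w) c with clean-ʳ++ w c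
  ... | no-021 , no-τ = no-021 ∘ Has021-tail , no-τ ∘ has-tail

  accepts⁻ : ∀ {s r w} → Inv s r → Accepts s w → AscFrom r w × Clean Has (w ʳ++ r)
  accepts⁻ inv []        = [] , inv-clean inv
  accepts⁻ inv (e ∷ acc) with sound inv e
  ... | le , inv′ with accepts⁻ inv′ acc
  ...   | A , c = le ∷ A , c

  accepts⁺ : ∀ {s r w} → Inv s r → AscFrom r w → Clean Has (w ʳ++ r) → Accepts s w
  accepts⁺ inv []                     _ = []
  accepts⁺ inv (_∷_ {w = w} le A) c with complete inv (clean-ʳ++ w c) le
  -- `complete` only finds the edge; the invariant at its end comes from `sound`.
  ... | s′ , e = e ∷ accepts⁺ (proj₂ (sound inv e)) A c

  -- The automaton starts after the forced first letter 0, which accounts for the shift from `suc n`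
  -- to `n`.
  B⇔gen : ∀ {s} → Inv s [ 0 ] → ∀ n {w} → B (suc n) τ w ⇔ w ∈ map (0 ∷_) (gen n s)
  B⇔gen {s} inv n {w} = mk⇔ ⇒ ⇐
    where
    ⇒ : ∀ {w} → B (suc n) τ w → w ∈ map (0 ∷_) (gen n s)
    ⇒ {x ∷ w} (refl , A , no-021 , no-τ) with IsAscentSequence-∷ x w .to A
    ... | refl , A′ = ∈-map⁺ (0 ∷_) (∈-gen⁺ (accepts⁺ inv A′
      (no-021 ∘ contains-021 (0 ∷ w) .from , no-τ ∘ contains (0 ∷ w) .from)))

    ⇐ : ∀ {w} → w ∈ map (0 ∷_) (gen n s) → B (suc n) τ w
    ⇐ w∈ with ∈-map⁻ (0 ∷_) w∈
    ... | v , v∈ , refl with ∈-gen⁻ n v∈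
    ...   | len , acc with accepts⁻ inv acc
    ...     | A , no-021 , no-τ = cong suc len , IsAscentSequence-∷ 0 v .from (refl , A) ,
      no-021 ∘ contains-021 (0 ∷ v) .to , no-τ ∘ contains (0 ∷ v) .to

  -- Two duplicate-free lists with the same members are permutations of each other, hence equally
  -- long.
  b-suc : ∀ {s} → Inv s [ 0 ] → ∀ n → b (suc n) τ ≡ length (gen n s)
  b-suc {s} inv n = trans
    (↭-length (∼bag⇒↭ (unique∧set⇒bag (listB-unique (suc n) τ)
      (map⁺ ∷-injectiveʳ (gen-unique distinct n s))
      (λ {w} → B⇔gen inv n ⇔-∘ ∈-listB (suc n) τ w))))
    (length-map (0 ∷_) (gen n s))

-- `powers n` is 2 ^ n, `ramp` is s and `total` is z of the overview; in closed form s n = (n + 2) 2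
-- ^ n / 2 and z n = 1 + n 2 ^ n / 2.
powers ramp total : ℕ → ℕ
powers zero    = 1
powers (suc n) = powers n + powers n
ramp zero      = 1
ramp (suc n)   = ramp n + (ramp n + powers n)
total zero     = 1
total (suc n)  = total n + ramp n

-- The automaton for 0112

module Avoiding0112 where

  -- In climb m the nonzero letters read so far are 1, …, m in this order; in
  -- repeat m they are 1, …, m + 1 in this order, followed by further copies of m + 1.
  data State : Set where
    climb  : ℕ → State
    repeat : ℕ → State

  next : State → List (ℕ × State)
  next (climb zero)    = (0 , climb 0) ∷ (1 , climb 1) ∷ []
  next (climb (suc m)) =
    (0 , climb (suc m)) ∷ (suc m , repeat m) ∷ (suc (suc m) , climb (suc (suc m))) ∷ []
  next (repeat m)      = (0 , repeat m) ∷ (suc m , repeat m) ∷ []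

  has-tail : ∀ {x r} → Has0112 r → Has0112 (x ∷ r)
  has-tail (has0112 x<y y<z p) = has0112 x<y y<z (_ ∷ʳ p)

  -- In `repeat m` the ascents grow with each return from 0 to `suc m`, so they are only bounded
  -- below. The bound admits `suc m` again, and the stored 0, m + 1, m + 1 forbids anything larger.
  Inv : State → List ℕ → Set
  Inv (climb m)  r = Reach m m r × (∀ x → ¬ suc x ∷ suc x ∷ [] ⊆ r)
  Inv (repeat m) r = ∃[ a ] suc m ≤ a × Reach (suc m) a r ×
    suc m ∷ suc m ∷ 0 ∷ [] ⊆ r × (∀ x → x < m → ¬ suc x ∷ suc x ∷ [] ⊆ r)

  -- The letter y of a 0112 is positive and occurs twice, which `climb` excludes. In `repeat m` it
  -- also lies below some letter, hence below m + 1, the only nonzero letter that may repeat there.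
  inv-clean : ∀ {s r} → Inv s r → Clean Has0112 r
  inv-clean {climb m}  (R , once) = no-021 R ,
    λ { (has0112 {y = suc y} _ _ p) → once y (⊆-trans (refl ∷ refl ∷ minimum _) (∷ˡ⁻ p)) }
  inv-clean {repeat m} (a , _ , R , _ , once) = no-021 R ,
    λ { (has0112 {y = suc y} _ y<z p) → once y (s<s⁻¹ (<-≤-trans y<z (∈-bounded R p)))
                                             (⊆-trans (refl ∷ refl ∷ minimum _) (∷ˡ⁻ p)) }

  once-zero : ∀ {x r} → suc x ∷ suc x ∷ [] ⊆ 0 ∷ r → suc x ∷ suc x ∷ [] ⊆ r
  once-zero = ∷ʳ⁻ λ ()

  once-new : ∀ {m a r x} → Reach m a r → (∀ x → ¬ suc x ∷ suc x ∷ [] ⊆ r) →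
             ¬ suc x ∷ suc x ∷ [] ⊆ suc m ∷ r
  once-new R once (refl ∷ p) = <⇒≱ ≤-refl (∈-bounded R p)
  once-new R once (_ ∷ʳ p)   = once _ p

  sound : ∀ {s r x s′} → Inv s r → (x , s′) ∈ next s → x ≤ asc (reverse r) + 1 × Inv s′ (x ∷ r)
  sound {climb zero} (R , once) (here refl) =
    z≤n , reach-zero R , λ x p → once x (once-zero p)
  sound {climb zero} (R , once) (there (here refl)) =
    letter-bound⁻ R ≤-refl , reach-> z<s R , λ _ → once-new R once
  sound {climb (suc m)} (R , once) (here refl) =
    z≤n , reach-zero R , λ x p → once x (once-zero p)
  sound {climb (suc m)} {h ∷ r} (R , once) (there (here refl)) =
    letter-bound⁻ R (n≤1+n _) , _ ,
    ≤-trans (≤-reflexive (sym (ascents R))) (asc-≤ (suc m) h r) ,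
    reach-≥ ≤-refl R , refl ∷ has-top R z<s ,
    λ x x<m p → once x (∷ʳ⁻ (<⇒≢ (s<s x<m)) p)
  sound {climb (suc m)} (R , once) (there (there (here refl))) =
    letter-bound⁻ R ≤-refl , reach-> ≤-refl R , λ _ → once-new R once
  sound {repeat m} (a , m<a , R , top , once) (here refl) =
    z≤n , a , m<a , reach-zero R , _ ∷ʳ top , λ x x<m p → once x x<m (once-zero p)
  sound {repeat m} {h ∷ r} (a , m<a , R , top , once) (there (here refl)) =
    letter-bound⁻ R (≤-trans m<a (n≤1+n _)) , _ ,
    ≤-trans (≤-trans m<a (≤-reflexive (sym (ascents R)))) (asc-≤ (suc m) h r) ,
    reach-≥ ≤-refl R , _ ∷ʳ top ,
    λ x x<m p → once x x<m (∷ʳ⁻ (<⇒≢ (s<s x<m)) p)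

  -- Avoiding 021 leaves 0 and the letters from the largest one upwards. These are cut off by the
  -- ascent bound in `climb` and by 0112 in `repeat`.
  complete : ∀ {s r x} → Inv s r → Clean Has0112 (x ∷ r) → x ≤ asc (reverse r) + 1 →
             ∃[ s′ ] (x , s′) ∈ next s
  complete {climb m} (R , _) (c , _) le with zero-or-top R c
  complete {climb zero}    (R , _) (c , _) le | inj₁ refl = _ , here refl
  complete {climb (suc m)} (R , _) (c , _) le | inj₁ refl = _ , here refl
  complete {climb m}       (R , _) (c , _) le | inj₂ m≤x with ≤1+-split m≤x (letter-bound R le)
  complete {climb zero}    (R , _) (c , _) le | inj₂ m≤x | inj₁ refl = _ , here refl
  complete {climb zero}    (R , _) (c , _) le | inj₂ m≤x | inj₂ refl = _ , there (here refl)
  complete {climb (suc m)} (R , _) (c , _) le | inj₂ m≤x | inj₁ refl = _ , there (here refl)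
  complete {climb (suc m)} (R , _) (c , _) le | inj₂ m≤x | inj₂ refl = _ , there (there (here refl))
  complete {repeat m} (a , m<a , R , top , once) (c , d) le with zero-or-top R c
  ... | inj₁ refl = _ , here refl
  ... | inj₂ m<x with m≤n⇒m<n∨m≡n m<x
  ...   | inj₁ 1+m<x = contradiction (has0112 z<s 1+m<x (refl ∷ top)) d
  ...   | inj₂ refl  = _ , there (here refl)

  inv-init : Inv (climb 0) [ 0 ]
  inv-init = reach-init , λ { _ (_ ∷ʳ ()) }

  distinct : ∀ s → Unique (map proj₁ (next s))
  distinct (climb zero)    = ((λ ()) ∷ []) ∷ [] ∷ []
  distinct (climb (suc m)) = ((λ ()) ∷ (λ ()) ∷ []) ∷ ((λ ()) ∷ []) ∷ [] ∷ []
  distinct (repeat m)      = ((λ ()) ∷ []) ∷ [] ∷ []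

  -- The index m only shifts letters, except at `climb 0`, where the largest letter is 0 itself and
  -- two edges coincide.
  paths : ℕ → State → ℕ
  paths n (climb zero)    = total n
  paths n (climb (suc _)) = ramp n
  paths n (repeat _)      = powers n

  paths-zero : ∀ s → paths 0 s ≡ 1
  paths-zero (climb zero)    = refl
  paths-zero (climb (suc _)) = refl
  paths-zero (repeat _)      = refl

  paths-suc : ∀ n s → paths (suc n) s ≡ sum (map (paths n ∘ proj₂) (next s))
  paths-suc n (climb zero)    = identity (total n) (ramp n)
    where
    identity : ∀ z s → z + s ≡ z + (s + 0)
    identity = ℕSolver.solve-∀
  paths-suc n (climb (suc _)) = identity (ramp n) (powers n)
    where
    identity : ∀ s t → s + (s + t) ≡ s + (t + (s + 0))
    identity = ℕSolver.solve-∀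
  paths-suc n (repeat _)      = identity (powers n)
    where
    identity : ∀ t → t + t ≡ t + (t + 0)
    identity = ℕSolver.solve-∀

  b-total : ∀ n → b (suc n) (0 ∷ 1 ∷ 1 ∷ 2 ∷ []) ≡ total n
  b-total n = trans
    (Counting.b-suc next distinct contains-0112 has-tail Inv inv-clean sound complete inv-init n)
    (Generation.length-gen next paths paths-zero paths-suc n (climb 0))

-- The automaton for 0011

module Avoiding0011 where

  -- The largest letter read so far is m in climb m and tight m, and m + 1 in the
  -- other three states.  The second zero separates climb and plateau from reset
  -- and slack.
  --   climb:   no letter has been repeated;
  --   plateau: the largest letter, and only it, has been repeated;
  --   reset:   only zeros since the second zero, so the largest letter may still
  --            come once more;
  --   slack:   it did come again, giving one ascent more than distinct nonzero
  --            letters, so that later one letter may be skipped;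
  --   tight:   neither repeating the largest letter nor skipping one is possible.
  data State : Set where
    climb   : ℕ → State
    plateau : ℕ → State
    reset   : ℕ → State
    slack   : ℕ → State
    tight   : ℕ → State

  next : State → List (ℕ × State)
  next (climb zero)    = (0 , tight 0) ∷ (1 , climb 1) ∷ []
  next (climb (suc m)) =
    (0 , reset m) ∷ (suc m , plateau m) ∷ (suc (suc m) , climb (suc (suc m))) ∷ []
  next (plateau m)     =
    (0 , reset m) ∷ (suc m , plateau m) ∷ (suc (suc m) , tight (suc (suc m))) ∷ []
  next (reset m)       =
    (0 , reset m) ∷ (suc m , slack m) ∷ (suc (suc m) , tight (suc (suc m))) ∷ []
  next (slack m)       =
    (0 , slack m) ∷ (suc (suc m) , slack (suc m)) ∷
    (suc (suc (suc m)) , tight (suc (suc (suc m)))) ∷ []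
  next (tight m)       = (0 , tight m) ∷ (suc m , tight (suc m)) ∷ []

  has-tail : ∀ {x r} → Has0011 r → Has0011 (x ∷ r)
  has-tail (has0011 x<y p) = has0011 x<y (_ ∷ʳ p)

  clean-zero : ∀ {r} → ¬ Has0011 r → ¬ Has0011 (0 ∷ r)
  clean-zero d (has0011 x<y (_ ∷ʳ p)) = d (has0011 x<y p)
  clean-zero d (has0011 () (refl ∷ p))

  clean-new : ∀ {m n a r} → Reach m a r → m < n → ¬ Has0011 r → ¬ Has0011 (n ∷ r)
  clean-new R m<n d (has0011 x<y (refl ∷ p)) = <⇒≱ m<n (∈-bounded R p)
  clean-new R m<n d (has0011 x<y (_ ∷ʳ p))   = d (has0011 x<y p)

  clean-top : ∀ {m r} → (∀ x → x < m → ¬ m ∷ x ∷ x ∷ [] ⊆ r) → ¬ Has0011 r → ¬ Has0011 (m ∷ r)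
  clean-top last d (has0011 x<y (refl ∷ p)) = last _ x<y p
  clean-top last d (has0011 x<y (_ ∷ʳ p))   = d (has0011 x<y p)

  -- The last letter is recorded where it decides whether repeating the largest letter adds an
  -- ascent: none after that letter itself, one after 0. The final clause of `tight` is conditional
  -- because a largest letter 0 may still be repeated.
  Specific : State → List ℕ → Set
  Specific (climb m)   r = Reach m m r × (∃[ r′ ] r ≡ m ∷ r′) × (∀ x → ¬ x ∷ x ∷ [] ⊆ r)
  Specific (plateau m) r = Reach (suc m) (suc m) r × (∃[ r′ ] r ≡ suc m ∷ r′) ×
    suc m ∷ suc m ∷ [] ⊆ r × (∀ x → x < suc m → ¬ x ∷ x ∷ [] ⊆ r)
  Specific (reset m)   r = Reach (suc m) (suc m) r × (∃[ r′ ] r ≡ 0 ∷ r′) ×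
    0 ∷ 0 ∷ [] ⊆ r × (∀ x → x < suc m → ¬ suc m ∷ x ∷ x ∷ [] ⊆ r)
  Specific (slack m)   r = Reach (suc m) (suc (suc m)) r × suc m ∷ 0 ∷ 0 ∷ [] ⊆ r
  Specific (tight m)   r = Reach m m r × ∃[ x ] x ≤ m × x ∷ x ∷ [] ⊆ r ×
    (0 < m → x < m × m ∷ x ∷ x ∷ [] ⊆ r)

  Inv : State → List ℕ → Set
  Inv s r = ¬ Has0011 r × Specific s r

  specific-021 : ∀ s {r} → Specific s r → ¬ Has021 r
  specific-021 (climb m)   (R , _) = no-021 R
  specific-021 (plateau m) (R , _) = no-021 R
  specific-021 (reset m)   (R , _) = no-021 R
  specific-021 (slack m)   (R , _) = no-021 R
  specific-021 (tight m)   (R , _) = no-021 R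

  inv-clean : ∀ {s r} → Inv s r → Clean Has0011 r
  inv-clean {s} (d , P) = specific-021 s P , d

  once-new : ∀ {m n a r} → Reach m a r → m < n → (∀ x → ¬ x ∷ x ∷ [] ⊆ r) →
             ∀ x → ¬ x ∷ x ∷ [] ⊆ n ∷ r
  once-new R m<n once x (refl ∷ p) = <⇒≱ m<n (∈-bounded R p)
  once-new R m<n once x (_ ∷ʳ p)   = once x p

  -- The repeated x followed by the new letter m + 1 bars a second m + 1, while the ascent count
  -- keeps pace with the largest letter.
  tight-new : ∀ {m r x} → x ≤ m → x ∷ x ∷ [] ⊆ r → Reach m m r →
              Specific (tight (suc m)) (suc m ∷ r)
  tight-new x≤m p R = reach-> ≤-refl R , _ , m≤n⇒m≤1+n x≤m , _ ∷ʳ p , λ _ → s≤s x≤m , refl ∷ p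

  stays : ∀ {m r} → Reach m m (m ∷ r) → Reach m m (m ∷ m ∷ r)
  stays {m} {r} R = subst (λ a → Reach m a (m ∷ m ∷ r))
    (trans (asc-non-ascent {m} {m} {r} ≤-refl) (ascents R)) (reach-≥ ≤-refl R)

  sound : ∀ {s r x s′} → Inv s r → (x , s′) ∈ next s → x ≤ asc (reverse r) + 1 × Inv s′ (x ∷ r)
  sound {climb zero} (d , R , _ , once) (here refl) =
    z≤n , clean-zero d , reach-zero R , 0 , z≤n , refl ∷ has-zero R , λ ()
  sound {climb zero} (d , R , _ , once) (there (here refl)) =
    letter-bound⁻ R ≤-refl , clean-new R z<s d , reach-> z<s R , (_ , refl) ,
    once-new R z<s once
  sound {climb (suc m)} (d , R , _ , once) (here refl) =
    z≤n , clean-zero d , reach-zero R , (_ , refl) , refl ∷ has-zero R ,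
    λ x _ p → once x (∷ˡ⁻ (∷ʳ⁻ (λ ()) p))
  sound {climb (suc m)} (d , R , (_ , refl) , once) (there (here refl)) =
    letter-bound⁻ R (n≤1+n _) , clean-top (λ x _ p → once x (∷ˡ⁻ p)) d ,
    stays R , (_ , refl) , refl ∷ refl ∷ minimum _ ,
    λ x x<m p → once x (∷ʳ⁻ (<⇒≢ x<m) p)
  sound {climb (suc m)} (d , R , _ , once) (there (there (here refl))) =
    letter-bound⁻ R ≤-refl , clean-new R ≤-refl d , reach-> ≤-refl R , (_ , refl) ,
    once-new R ≤-refl once
  sound {plateau m} (d , R , _ , twice , once) (here refl) =
    z≤n , clean-zero d , reach-zero R , (_ , refl) , refl ∷ has-zero R ,
    λ x x<m p → once x x<m (∷ˡ⁻ (∷ʳ⁻ (λ ()) p))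
  sound {plateau m} (d , R , (_ , refl) , twice , once) (there (here refl)) =
    letter-bound⁻ R (n≤1+n _) , clean-top (λ x x<m p → once x x<m (∷ˡ⁻ p)) d ,
    stays R , (_ , refl) , _ ∷ʳ twice , λ x x<m p → once x x<m (∷ʳ⁻ (<⇒≢ x<m) p)
  sound {plateau m} (d , R , _ , twice , once) (there (there (here refl))) =
    letter-bound⁻ R ≤-refl , clean-new R ≤-refl d , tight-new ≤-refl twice R
  sound {reset m} (d , R , _ , zeros , last) (here refl) =
    z≤n , clean-zero d , reach-zero R , (_ , refl) , _ ∷ʳ zeros ,
    λ x x<m p → last x x<m (∷ʳ⁻ (λ ()) p)
  sound {reset m} (d , R , (r , refl) , zeros , last) (there (here refl)) =
    letter-bound⁻ R (n≤1+n _) , clean-top last d ,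
    -- Returning from 0 to `suc m` is an ascent without a new letter: this creates the slack.
    subst (λ a → Reach (suc m) a (suc m ∷ 0 ∷ r))
      (trans (asc-ascent {suc m} {0} {r} z<s) (cong suc (ascents R))) (reach-≥ ≤-refl R) ,
    refl ∷ zeros
  sound {reset m} (d , R , _ , zeros , last) (there (there (here refl))) =
    letter-bound⁻ R ≤-refl , clean-new R ≤-refl d , tight-new z≤n zeros R
  sound {slack m} (d , R , p) (here refl) =
    z≤n , clean-zero d , reach-zero R , _ ∷ʳ p
  sound {slack m} (d , R , p) (there (here refl)) =
    letter-bound⁻ R (n≤1+n _) , clean-new R ≤-refl d , reach-> ≤-refl R , refl ∷ ∷ˡ⁻ p
  sound {slack m} (d , R , p) (there (there (here refl))) =
    -- Skipping m + 2 spends the slack: ascents and largest letter are both m + 3. The repeated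
    -- letter is 0.
    letter-bound⁻ R ≤-refl , clean-new R (n≤1+n _) d , reach-> (n≤1+n _) R ,
    0 , z≤n , _ ∷ʳ ∷ˡ⁻ p , λ _ → z<s , refl ∷ ∷ˡ⁻ p
  sound {tight m} (d , R , x , x≤m , twice , below) (here refl) =
    z≤n , clean-zero d , reach-zero R , x , x≤m , _ ∷ʳ twice ,
    λ 0<m → proj₁ (below 0<m) , _ ∷ʳ proj₂ (below 0<m)
  sound {tight m} (d , R , x , x≤m , twice , below) (there (here refl)) =
    letter-bound⁻ R ≤-refl , clean-new R ≤-refl d , tight-new x≤m twice R

  complete : ∀ {s r x} → Inv s r → Clean Has0011 (x ∷ r) → x ≤ asc (reverse r) + 1 →
             ∃[ s′ ] (x , s′) ∈ next s
  complete {climb zero} (_ , R , _) (c , d) le with zero-or-top R c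
  ... | inj₁ refl = _ , here refl
  ... | inj₂ m≤x with ≤1+-split m≤x (letter-bound R le)
  ...   | inj₁ refl = _ , here refl
  ...   | inj₂ refl = _ , there (here refl)
  complete {climb (suc m)} (_ , R , _) (c , d) le with zero-or-top R c
  ... | inj₁ refl = _ , here refl
  ... | inj₂ m≤x with ≤1+-split m≤x (letter-bound R le)
  ...   | inj₁ refl = _ , there (here refl)
  ...   | inj₂ refl = _ , there (there (here refl))
  complete {plateau m} (_ , R , _) (c , d) le with zero-or-top R c
  ... | inj₁ refl = _ , here refl
  ... | inj₂ m≤x with ≤1+-split m≤x (letter-bound R le)
  ...   | inj₁ refl = _ , there (here refl)
  ...   | inj₂ refl = _ , there (there (here refl))
  complete {reset m} (_ , R , _) (c , d) le with zero-or-top R c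
  ... | inj₁ refl = _ , here refl
  ... | inj₂ m≤x with ≤1+-split m≤x (letter-bound R le)
  ...   | inj₁ refl = _ , there (here refl)
  ...   | inj₂ refl = _ , there (there (here refl))
  complete {slack m} (_ , R , p) (c , d) le with zero-or-top R c
  ... | inj₁ refl = _ , here refl
  ... | inj₂ m≤x with m≤n⇒m<n∨m≡n m≤x
  -- A second m + 1 after 0, 0, m + 1 would complete 0011.
  ...   | inj₂ refl = contradiction (has0011 z<s (refl ∷ p)) d
  ...   | inj₁ m<x with ≤1+-split m<x (letter-bound R le)
  ...     | inj₁ refl = _ , there (here refl)
  ...     | inj₂ refl = _ , there (there (here refl))
  complete {tight m} (_ , R , x , x≤m , twice , below) (c , d) le with zero-or-top R c
  ... | inj₁ refl = _ , here refl
  ... | inj₂ m≤x with ≤1+-split m≤x (letter-bound R le)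
  ...   | inj₂ refl = _ , there (here refl)
  complete {tight zero} (_ , R , x , x≤m , twice , below) (c , d) le | inj₂ m≤x | inj₁ refl =
    _ , here refl
  complete {tight (suc m)} (_ , R , x , x≤m , twice , below) (c , d) le | inj₂ m≤x | inj₁ refl =
    contradiction (has0011 (proj₁ (below z<s)) (refl ∷ proj₂ (below z<s))) d

  inv-init : Inv (climb 0) [ 0 ]
  inv-init = (λ { (has0011 _ (_ ∷ʳ ())) ; (has0011 _ (_ ∷ ())) }) , reach-init , (_ , refl) ,
    λ { _ (_ ∷ʳ ()) ; _ (_ ∷ ()) }

  distinct : ∀ s → Unique (map proj₁ (next s))
  distinct (climb zero)    = ((λ ()) ∷ []) ∷ [] ∷ []
  distinct (climb (suc m)) = ((λ ()) ∷ (λ ()) ∷ []) ∷ ((λ ()) ∷ []) ∷ [] ∷ []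
  distinct (plateau m)     = ((λ ()) ∷ (λ ()) ∷ []) ∷ ((λ ()) ∷ []) ∷ [] ∷ []
  distinct (reset m)       = ((λ ()) ∷ (λ ()) ∷ []) ∷ ((λ ()) ∷ []) ∷ [] ∷ []
  distinct (slack m)       = ((λ ()) ∷ (λ ()) ∷ []) ∷ ((λ ()) ∷ []) ∷ [] ∷ []
  distinct (tight m)       = ((λ ()) ∷ []) ∷ [] ∷ []

  climbs : ℕ → ℕ
  climbs zero    = 1
  climbs (suc n) = ramp n + (ramp n + climbs n)

  -- The left side counts the two edges of `climb 0`, into `tight 0` and `climb 1`; so the count
  -- agrees with that for 0112. In the induction one copy of `powers n` moves over to complete
  -- `ramp (suc n)`.
  powers+climbs : ∀ n → powers n + climbs n ≡ total (suc n)
  powers+climbs zero    = refl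
  powers+climbs (suc n) = trans (identity (powers n) (ramp n) (climbs n))
    (cong (λ k → k + ramp (suc n)) (powers+climbs n))
    where
    identity : ∀ t s u → (t + t) + (s + (s + u)) ≡ (t + u) + (s + (s + t))
    identity = ℕSolver.solve-∀

  -- `plateau`, `reset` and `slack` share one count: each has two edges into these three kinds and
  -- one into `tight`.
  paths : ℕ → State → ℕ
  paths n (climb zero)    = total n
  paths n (climb (suc _)) = climbs n
  paths n (plateau _)     = ramp n
  paths n (reset _)       = ramp n
  paths n (slack _)       = ramp n
  paths n (tight _)       = powers n

  paths-zero : ∀ s → paths 0 s ≡ 1
  paths-zero (climb zero)    = refl
  paths-zero (climb (suc _)) = refl
  paths-zero (plateau _)     = refl
  paths-zero (reset _)       = refl
  paths-zero (slack _)       = refl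
  paths-zero (tight _)       = refl

  pad₂ : ∀ k l → k + l ≡ k + (l + 0)
  pad₂ k l = cong (λ i → k + i) (sym (+-identityʳ l))

  pad₃ : ∀ k l m → k + (l + m) ≡ k + (l + (m + 0))
  pad₃ k l m = cong (λ i → k + i) (pad₂ l m)

  paths-suc : ∀ n s → paths (suc n) s ≡ sum (map (paths n ∘ proj₂) (next s))
  paths-suc n (climb zero)    = trans (sym (powers+climbs n)) (pad₂ (powers n) (climbs n))
  paths-suc n (climb (suc _)) = pad₃ (ramp n) (ramp n) (climbs n)
  paths-suc n (plateau _)     = pad₃ (ramp n) (ramp n) (powers n)
  paths-suc n (reset _)       = pad₃ (ramp n) (ramp n) (powers n)
  paths-suc n (slack _)       = pad₃ (ramp n) (ramp n) (powers n)
  paths-suc n (tight _)       = pad₂ (powers n) (powers n)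

  b-total : ∀ n → b (suc n) (0 ∷ 0 ∷ 1 ∷ 1 ∷ []) ≡ total n
  b-total n = trans
    (Counting.b-suc next distinct contains-0011 has-tail Inv inv-clean sound complete inv-init n)
    (Generation.length-gen next paths paths-zero paths-suc n (climb 0))

-- From the recurrence to the rational generating function

binomial numerator denominator : PowerSeries
binomial    = poly (+ 1 ∷ - (+ 2) ∷ [])
numerator   = poly (+ 1 ∷ - (+ 4) ∷ + 5 ∷ - (+ 1) ∷ [])
denominator = poly (+ 1 ∷ - (+ 1) ∷ []) · (binomial · binomial)

poly[]-· : ∀ g n → (poly [] · g) n ≡ 0ℤ
poly[]-· g zero    = refl
poly[]-· g (suc n) = trans (ℤ.+-identityˡ _) (poly[]-· g n)

-- Products with coefficients past the end of a polynomial compute to `0ℤ`, so all remaining terms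
-- end in the same sum of zeros and a single rewrite clears them.
denominator-vanishes : ∀ n → denominator (4 + n) ≡ 0ℤ
denominator-vanishes n rewrite poly[]-· (binomial · binomial) (2 + n) = refl

-- 1 - 5x + 8x² - 4x³ is the expanded denominator.
·-denominator : ∀ f n → (f · denominator) (3 + n) ≡
  f n ℤ.* - + 4 ℤ.+ (f (1 + n) ℤ.* + 8 ℤ.+ (f (2 + n) ℤ.* - + 5 ℤ.+ f (3 + n) ℤ.* + 1))
·-denominator f zero    = refl
·-denominator f (suc n) = trans
  (cong₂ ℤ._+_ (trans (cong (f 0 ℤ.*_) (denominator-vanishes n)) (ℤ.*-zeroʳ (f 0)))
               (·-denominator (f ∘ suc) n))
  (ℤ.+-identityˡ _)

-- Writing the later values through z n, s n and 2 ^ n leaves a linear identity in these three.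
total-recurrence : ∀ n → let f = +_ ∘ total in
  f n ℤ.* - + 4 ℤ.+ (f (1 + n) ℤ.* + 8 ℤ.+ (f (2 + n) ℤ.* - + 5 ℤ.+ f (3 + n) ℤ.* + 1)) ≡ 0ℤ
total-recurrence n = identity (+ total n) (+ ramp n) (+ powers n)
  where
  identity : ∀ z s t →
    let s₁ = s ℤ.+ (s ℤ.+ t) ; t₁ = t ℤ.+ t ; s₂ = s₁ ℤ.+ (s₁ ℤ.+ t₁)
        z₁ = z ℤ.+ s ; z₂ = z₁ ℤ.+ s₁ ; z₃ = z₂ ℤ.+ s₂
    in z ℤ.* - + 4 ℤ.+ (z₁ ℤ.* + 8 ℤ.+ (z₂ ℤ.* - + 5 ℤ.+ z₃ ℤ.* + 1)) ≡ 0ℤ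
  identity = ℤSolver.solve-∀

-- Degrees 0 to 3 involve `f 0`, which lies outside `total`; evaluated directly, they yield the
-- numerator. From degree 4 on the recurrence gives 0.
total-series : ∀ f → f 0 ≡ 1ℤ → (∀ n → f (suc n) ≡ + total n) → f · denominator ≈ numerator
total-series f f₀ f₊ 0 rewrite f₀ = refl
total-series f f₀ f₊ 1 rewrite f₀ | f₊ 0 = refl
total-series f f₀ f₊ 2 rewrite f₀ | f₊ 0 | f₊ 1 = refl
total-series f f₀ f₊ 3 rewrite f₀ | f₊ 0 | f₊ 1 | f₊ 2 = refl
total-series f f₀ f₊ (suc (suc (suc (suc n))))
  rewrite ·-denominator f (suc n) | f₊ n | f₊ (1 + n) | f₊ (2 + n) | f₊ (3 + n) = total-recurrence n

theorem2p2 : (τ : List ℕ) →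
    (τ ≡ 0 ∷ 0 ∷ 1 ∷ 1 ∷ [] ⊎ τ ≡ 0 ∷ 1 ∷ 1 ∷ 2 ∷ []) →
    genFun τ ≈
    poly (+ 1 ∷ - (+ 4) ∷ + 5 ∷ - (+ 1) ∷ [])
    / poly (+ 1 ∷ - (+ 1) ∷ [])
    · (poly (+ 1 ∷ - (+ 2) ∷ []) · poly (+ 1 ∷ - (+ 2) ∷ [])) ⟨ refl ⟩
theorem2p2 τ (inj₁ refl) = /-unique (genFun τ) numerator denominator refl
  -- The constant term is found by evaluation: `b 0 τ` reduces to 1.
  (total-series (genFun τ) refl (λ n → cong +_ (Avoiding0011.b-total n)))
theorem2p2 τ (inj₂ refl) = /-unique (genFun τ) numerator denominator refl
  (total-series (genFun τ) refl (λ n → cong +_ (Avoiding0112.b-total n)))
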